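{- The decision problem $(CNF, SAT)$ has the strong internal independence property. That is, for all positive integers $n, m$, writing $E = CNF^{nm}$ and $F = SAT^{nm}$, and for any choice of finitely many distinct strings $f_1,\dots,f_s$ in the reduced logogram $|Log_E(F)|$, the following holds: for every $i \in \{1,\dots,s\}$ there exists a word $x_i \in E$ such that $x_i \ge f_i$ and $x_i \not\ge f_j$ for every $j \in \{1,\dots,s\}$ with $j \neq i$.
   Context: Let $\Sigma$ be a finite alphabet and $N$ the set of positive integers. A string over $\Sigma$ is a partial function $N \to \Sigma$ with finite domain; $\Sigma_\infty$ is the set of all strings. A word over $\Sigma$ is identified with the string whose domain is an initial segment $\{1,\dots,\ell\}$ of $N$. For strings $f, g$, write $f \le g$ (equivalently $g \ge f$; "$g$ includes $f$") if $Dom(f) \subseteq Dom(g)$ and $g$ agrees with $f$ on $Dom(f)$. For a set of words $E$, $\Sigma_\infty(E)$ is the set of strings $g$ such that some $x \in E$ satisfies $x \ge g$. For $H \subseteq \Sigma_\infty(E)$, $E^H = \{x \in E : \exists a \in H,\ x \ge a\}$. For $F \subseteq E$ the logogram is $Log_E(F) = \{g \in \Sigma_\infty(E) : \forall x \in E\ (x \ge g \Rightarrow x \in E^F)\}$, where $F$ is viewed as a set of strings. The reduced logogram $|Log_E(F)|$ is the set of $\le$-minimal elements of $Log_E(F)$, i.e. those that do not include any other element of $Log_E(F)$. A decision problem $(E,F)$ has the strong internal independence property if, for any distinct strings $f_1,\dots,f_s$ in $|Log_E(F)|$ and every $i$, there is a word $x_i \in E$ that includes $f_i$ and includes none of the other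 strings among $f_1,\dots,f_s$. Encoding of CNF: $\Sigma = \{0,1,2\}$. A clause over variables $v_1,\dots,v_n$ is encoded as a word of length $n$ over $\Sigma$, where the $k$-th letter is $0$ if $v_k$ does not occur, $1$ if the literal $v_k$ occurs, $2$ if the literal $\neg v_k$ occurs. A formula with $n$ variables and $m$ clauses is encoded as the concatenation of its $m$ clause codes. $CNF^{nm}$ is the set of all words of length $nm$ over $\{0,1,2\}$, each regarded as such a formula (an all-zero block is the empty, hence unsatisfiable, clause), and $SAT^{nm}$ is the set of those words in $CNF^{nm}$ encoding satisfiable formulas. -}

module Defs where

open import Data.Bool.Base using (Bool; true; false)
open import Data.Fin.Base using (Fin)
open import Data.Fin.Patterns using (1F; 2F)
open import Data.List.Base using (List; []; _∷_; length)
open import Data.Maybe using (Maybe; just; nothing; Is-just)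
open import Data.Nat.Base using (ℕ; zero; suc; _*_; _≤_; s≤s)
open import Data.Product.Base using (∃-syntax; _×_; proj₁)
open import Data.Vec.Base as Vec using (Vec; lookup; toList)
open import Data.Vec.Relation.Unary.All using (All)
open import Function.Definitions using (Injective)
open import Level using (0ℓ)
open import Relation.Binary.PropositionalEquality using (_≡_; _≢_; refl)
open import Relation.Nullary.Negation using (¬_)
open import Relation.Unary using (Pred; _∈_; _⊆_)

private
  variable
    q n m : ℕ

-- Finite partial functions from the positive integers to an alphabet of q
-- letters.  Positions are counted from 0: the index k stands for the positive
-- integer k + 1.
record String (q : ℕ) : Set where
  field
    at     : ℕ → Maybe (Fin q)
    bound  : ℕ
    finite : ∀ {k} → bound ≤ k → at k ≡ nothing

open String public

Dom : String q → Pred ℕ 0ℓ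
Dom f k = Is-just (at f k)

infix 4 _≈_ _≼_ _≽_

-- Equality of partial functions; the choice of bound is immaterial.
_≈_ : String q → String q → Set
f ≈ g = ∀ k → at f k ≡ at g k

_≼_ : String q → String q → Set
f ≼ g = Dom f ⊆ Dom g × (∀ {k} → k ∈ Dom f → at g k ≡ at f k)

_≽_ : String q → String q → Set
g ≽ f = f ≼ g

Word : ℕ → Set
Word q = List (Fin q)

letter : Word q → ℕ → Maybe (Fin q)
letter []      _       = nothing
letter (a ∷ _) zero    = just a
letter (_ ∷ w) (suc k) = letter w k

letter-beyond : (w : Word q) → ∀ {k} → length w ≤ k → letter w k ≡ nothing
letter-beyond []      _       = refl
letter-beyond (_ ∷ w) (s≤s l) = letter-beyond w l

⟦_⟧ : Word q → String q
⟦ w ⟧ = record { at = letter w ; bound = length w ; finite = letter-beyond w }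

asStrings : Pred (Word q) 0ℓ → Pred (String q) 0ℓ
asStrings F a = ∃[ y ] y ∈ F × a ≈ ⟦ y ⟧

Σ∞ : Pred (Word q) 0ℓ → Pred (String q) 0ℓ
Σ∞ E g = ∃[ x ] x ∈ E × ⟦ x ⟧ ≽ g

infixl 8 _^_

_^_ : Pred (Word q) 0ℓ → Pred (String q) 0ℓ → Pred (Word q) 0ℓ
(E ^ H) x = x ∈ E × ∃[ a ] a ∈ H × ⟦ x ⟧ ≽ a

record DecisionProblem (q : ℕ) : Set₁ where
  field
    E   : Pred (Word q) 0ℓ
    F   : Pred (Word q) 0ℓ
    F⊆E : F ⊆ E

module _ (P : DecisionProblem q) where
  open DecisionProblem P

  Log : Pred (String q) 0ℓ
  Log g = g ∈ Σ∞ E × (∀ x → x ∈ E → ⟦ x ⟧ ≽ g → x ∈ E ^ asStrings F)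

  ReducedLog : Pred (String q) 0ℓ
  ReducedLog g = g ∈ Log × (∀ h → h ∈ Log → g ≽ h → h ≈ g)

  StrongInternalIndependence : Set
  StrongInternalIndependence =
    ∀ (s : ℕ) (f : Fin s → String q) →
    (∀ i → f i ∈ ReducedLog) →
    Injective _≡_ _≈_ f →
    ∀ i → ∃[ x ] x ∈ E × ⟦ x ⟧ ≽ f i × (∀ j → j ≢ i → ¬ (⟦ x ⟧ ≽ f j))

data Literal (n : ℕ) : Set where
  pos neg : Fin n → Literal n

Assignment : ℕ → Set
Assignment n = Fin n → Bool

TrueUnder : Assignment n → Pred (Literal n) 0ℓ
TrueUnder α (pos k) = α k ≡ true
TrueUnder α (neg k) = α k ≡ false

ClauseCode : ℕ → Set
ClauseCode n = Vec (Fin 3) n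

-- Letter 0 at k: the k-th variable does not occur in the clause.
OccursIn : ClauseCode n → Pred (Literal n) 0ℓ
OccursIn c (pos k) = lookup c k ≡ 1F
OccursIn c (neg k) = lookup c k ≡ 2F

Satisfies : Assignment n → Pred (ClauseCode n) 0ℓ
Satisfies α c = ∃[ l ] l ∈ OccursIn c × l ∈ TrueUnder α

Satisfiable : Pred (Vec (ClauseCode n) m) 0ℓ
Satisfiable φ = ∃[ α ] All (Satisfies α) φ

CNF : ℕ → ℕ → Pred (Word 3) 0ℓ
CNF n m w = length w ≡ n * m

SAT : ℕ → ℕ → Pred (Word 3) 0ℓ
SAT n m w = w ∈ CNF n m ×
  ∃[ φ ] w ≡ toList (Vec.concat {m = n} {n = m} φ) × Satisfiable φ

CNF-SAT : ℕ → ℕ → DecisionProblem 3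
CNF-SAT n m = record { E = CNF n m ; F = SAT n m ; F⊆E = proj₁ }

{-# OPTIONS --safe #-}

-- The letter 0 contributes no literal, so a string in Σ∞ E lies in the logogram
-- exactly when filling its free positions with 0 gives a satisfiable formula.
-- Erasing the 0s of a member of the logogram thus leaves a member, and a minimal
-- member carries no 0.  Take x_i to be f_i filled with 0: an f_j included in x_i
-- has no 0, so it is included in f_i, hence equal to f_i by minimality.
module Submission where

open import Data.Empty using (⊥-elim)
open import Data.Fin.Base using (Fin; zero; suc; toℕ; combine)
open import Data.List.Base using (_∷_; length; applyUpTo)
open import Data.List.Properties using (length-applyUpTo)
open import Data.Maybe using (Maybe; just; nothing; fromMaybe; Is-just)
open import Data.Maybe.Properties using (just-injective)
open import Data.Maybe.Relation.Unary.Any using (just)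
open import Data.Nat.Base using (ℕ; zero; suc; _*_; _<_; z<s; s<s; s<s⁻¹; NonZero)
open import Data.Nat.Properties using (*-comm)
open import Data.Product.Base using (∃-syntax; _,_; proj₁; proj₂)
open import Data.Unit.Base using (tt)
open import Data.Vec.Base as Vec using (Vec; _∷_; lookup; toList)
open import Data.Vec.Properties using (lookup-concat; toList-cast; toList∘fromList)
open import Data.Vec.Relation.Unary.All.Properties using (lookup⁺; lookup⁻)
open import Relation.Binary.PropositionalEquality
open import Relation.Unary using (_∈_)
open import Defs

private
  variable
    q n m N : ℕ

-- With the converse `at⇒≼`, this lets inclusions be composed as implications between equations
-- `at f k ≡ just a`, without handling `Is-just` proofs.
≼⇒at : ∀ (f g : String q) → f ≼ g → ∀ {k a} → at f k ≡ just a → at g k ≡ just a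
≼⇒at _ _ (_ , agree) fk = trans (agree (subst Is-just (sym fk) (just tt))) fk

at⇒≼ : ∀ (f g : String q) → (∀ {k a} → at f k ≡ just a → at g k ≡ just a) → f ≼ g
at⇒≼ f g incl = dom , agree
  where
  agree : ∀ {k} → k ∈ Dom f → at g k ≡ at f k
  agree {k} k∈f with at f k in fk
  ... | just _ = incl fk

  dom : ∀ {k} → k ∈ Dom f → k ∈ Dom g
  dom k∈f = subst Is-just (sym (agree k∈f)) k∈f

letter⇒< : ∀ (w : Word q) {k a} → letter w k ≡ just a → k < length w
letter⇒< (_ ∷ _) {zero}  _  = z<s
letter⇒< (_ ∷ w) {suc k} wk = s<s (letter⇒< w wk)

letter-applyUpTo : ∀ (f : ℕ → Fin q) {k} → k < N → letter (applyUpTo f N) k ≡ just (f k)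
letter-applyUpTo {N = suc _} f {zero}  _   = refl
letter-applyUpTo {N = suc _} f {suc k} k<N = letter-applyUpTo (λ i → f (suc i)) (s<s⁻¹ k<N)

letter-toList : ∀ (v : Vec (Fin q) N) i → letter (toList v) (toℕ i) ≡ just (lookup v i)
letter-toList (_ ∷ _) zero    = refl
letter-toList (_ ∷ v) (suc i) = letter-toList v i

letter-concat : ∀ (φ : Vec (Vec (Fin q) n) m) i k →
  letter (toList (Vec.concat φ)) (toℕ (combine i k)) ≡ just (lookup (lookup φ i) k)
letter-concat φ i k =
  trans (letter-toList (Vec.concat φ) (combine i k)) (cong just (lookup-concat φ i k))

fill : ℕ → String (suc q) → Word (suc q)
fill N g = applyUpTo (λ k → fromMaybe zero (at g k)) N

-- The word `w` serves to bound the domain of `g`: every position of `g` lies below `N`, so cutting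
-- off at `N` loses no letter.
fill-≽ : ∀ (w : Word (suc q)) g → length w ≡ N → ⟦ w ⟧ ≽ g → ⟦ fill N g ⟧ ≽ g
fill-≽ w g refl w≽g = at⇒≼ g ⟦ fill (length w) g ⟧ λ gk →
  trans (letter-applyUpTo _ (letter⇒< w (≼⇒at g ⟦ w ⟧ w≽g gk)))
        (cong (λ v → just (fromMaybe zero v)) gk)

fill-nonblank : ∀ N (g : String (suc q)) {k a} →
  letter (fill N g) k ≡ just (suc a) → at g k ≡ just (suc a)
fill-nonblank N g {k} zk
  -- The letter exists, so `k` is below `N`. Were `k` free in `g`, the default `zero` would equal
  -- `suc a`.
  with at g k
     | trans (sym (letter-applyUpTo (λ i → fromMaybe zero (at g i))
                    (subst (k <_) (length-applyUpTo _ N) (letter⇒< (fill N g) zk)))) zk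
... | just _ | eq = eq

dropBlank : Maybe (Fin (suc q)) → Maybe (Fin (suc q))
dropBlank nothing        = nothing
dropBlank (just zero)    = nothing
dropBlank (just (suc a)) = just (suc a)

dropBlank-just : ∀ (v : Maybe (Fin (suc q))) {a} → dropBlank v ≡ just a → v ≡ just a
dropBlank-just (just (suc _)) eq = eq

dropBlank≢0 : ∀ (v : Maybe (Fin (suc q))) → dropBlank v ≢ just zero
dropBlank≢0 (just zero)    ()
dropBlank≢0 (just (suc _)) ()

strip : String (suc q) → String (suc q)
strip g = record
  { at     = λ k → dropBlank (at g k)
  ; bound  = bound g
  ; finite = λ b≤k → cong dropBlank (finite g b≤k)
  }

strip-≼ : (g : String (suc q)) → strip g ≼ g
strip-≼ g = at⇒≼ (strip g) g λ {k} → dropBlank-just (at g k)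

parse : ∀ {w} → w ∈ CNF n m → ∃[ φ ] w ≡ toList (Vec.concat {m = n} {n = m} φ)
parse {n} {m} {w} |w| =
  -- `Vec.concat` of `m` blocks of length `n` has length `m * n`, whereas `CNF` asks for `n * m`.
  let |w|′    = trans |w| (*-comm n m)
      φ , eq  = Vec.group m n (Vec.cast |w|′ (Vec.fromList w))
  in  φ , trans (sym (trans (toList-cast |w|′ (Vec.fromList w)) (toList∘fromList w)))
                (cong toList eq)

-- Nonzero letters are exactly the literals, so the literal that makes `c` true also occurs in `d`.
Satisfies-mono : ∀ {α} {c d : ClauseCode n} →
  (∀ k {a} → lookup c k ≡ suc a → lookup d k ≡ suc a) → Satisfies α c → Satisfies α d
Satisfies-mono c⊆d (pos k , occ , true-k) = pos k , c⊆d k occ , true-k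
Satisfies-mono c⊆d (neg k , occ , true-k) = neg k , c⊆d k occ , true-k

-- The assignment for `y` also works for `x`: both words split into blocks at the same positions,
-- and each clause of `x` keeps all literals of the matching clause of `y`.
SAT-mono : ∀ {y x} → y ∈ SAT n m → x ∈ CNF n m →
  (∀ {k a} → letter y k ≡ just (suc a) → letter x k ≡ just (suc a)) → x ∈ SAT n m
SAT-mono {n} {m} {x = x} (_ , φ , refl , α , sat) x∈E y⊆x with parse {n} {m} {x} x∈E
... | ψ , refl = x∈E , ψ , refl , α , lookup⁻ λ i →
  Satisfies-mono
    (λ k φik → just-injective (trans (sym (letter-concat ψ i k))
      (y⊆x (trans (letter-concat φ i k) (cong just φik)))))
    (lookup⁺ sat i)

module _ (n m : ℕ) where
  private
    P = CNF-SAT n m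
    E = CNF n m

    fill₀ : String 3 → Word 3
    fill₀ = fill (n * m)

  fill∈E : ∀ g → fill₀ g ∈ E
  fill∈E g = length-applyUpTo _ (n * m)

  Log⇒fill-≽ : ∀ g → g ∈ Log P → ⟦ fill₀ g ⟧ ≽ g
  Log⇒fill-≽ g ((w , w∈E , w≽g) , _) = fill-≽ w g w∈E w≽g

  strip∈Log : ∀ g → g ∈ Log P → strip g ∈ Log P
  strip∈Log g g∈Log@(_ , forced)
    with z≽g ← Log⇒fill-≽ g g∈Log
    -- The hypothesis on `g` is applied to a single word, its filling, and gives a satisfiable `y`
    -- included in that filling.
    with _ , b , (y , y∈SAT , b≈y) , z≽b ← forced (fill₀ g) (fill∈E g) z≽g =
      (fill₀ g , fill∈E g , z≽strip) , λ x x∈E x≽strip →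
        x∈E , ⟦ x ⟧ , (x , x∈SAT x x∈E x≽strip , λ _ → refl) , at⇒≼ ⟦ x ⟧ ⟦ x ⟧ (λ xk → xk)
    where
    z≽strip : ⟦ fill₀ g ⟧ ≽ strip g
    z≽strip = at⇒≼ (strip g) ⟦ fill₀ g ⟧ λ {k} sk →
      ≼⇒at g ⟦ fill₀ g ⟧ z≽g (dropBlank-just (at g k) sk)

    -- A literal of `y` is a nonzero letter of the filling, so it stems from `g` itself and survives
    -- the erasure of 0s. Every word that includes `strip g` therefore has all literals of `y`.
    y⊆strip : ∀ {k a} → letter y k ≡ just (suc a) → at (strip g) k ≡ just (suc a)
    y⊆strip {k} yk =
      cong dropBlank (fill-nonblank (n * m) g (≼⇒at b ⟦ fill₀ g ⟧ z≽b (trans (b≈y k) yk)))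

    x∈SAT : ∀ x → x ∈ E → ⟦ x ⟧ ≽ strip g → x ∈ SAT n m
    x∈SAT x x∈E x≽strip =
      SAT-mono y∈SAT x∈E (λ yk → ≼⇒at (strip g) ⟦ x ⟧ x≽strip (y⊆strip yk))

  -- Minimality forces `strip g` to equal `g`, and `strip g` has no 0.
  ReducedLog⇒nonblank : ∀ g → g ∈ ReducedLog P → ∀ {k} → at g k ≢ just zero
  ReducedLog⇒nonblank g (g∈Log , minimal) {k} gk =
    dropBlank≢0 (at g k) (trans (minimal (strip g) (strip∈Log g g∈Log) (strip-≼ g) k) gk)

  fill-≽⇒≽ : ∀ g h → h ∈ ReducedLog P → ⟦ fill₀ g ⟧ ≽ h → g ≽ h
  fill-≽⇒≽ g h h∈R z≽h = at⇒≼ h g λ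
    { {a = zero}  hk → ⊥-elim (ReducedLog⇒nonblank h h∈R hk)
    ; {a = suc _} hk → fill-nonblank (n * m) g (≼⇒at h ⟦ fill₀ g ⟧ z≽h hk)
    }

theorem8 : (n m : ℕ) → .{{_ : NonZero n}} → .{{_ : NonZero m}} →
    StrongInternalIndependence (CNF-SAT n m)
theorem8 n m s f f∈R f-injective i =
  fill (n * m) (f i) , fill∈E n m (f i) , Log⇒fill-≽ n m (f i) (proj₁ (f∈R i)) ,
  -- The minimality used here is that of `f i`, which includes the logogram member `f j`.
  λ j j≢i z≽fj → j≢i (f-injective
    (proj₂ (f∈R i) (f j) (proj₁ (f∈R j)) (fill-≽⇒≽ n m (f i) (f j) (f∈R j) z≽fj)))
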